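{- Given any two integers $r\ge 2$ and $k\ge 2$ such that $k$ is even, there exists a chordal graph $G_{r,k}$ such that $\mathrm{pc}_r(G_{r,k},k)\in\Omega\big(r2^{k/2}+r^2k^2\big)$. That is, there is an absolute constant $c>0$ such that for all integers $r\ge2$ and all even $k\ge 2$ there is a chordal graph $G_{r,k}$ with $\mathrm{pc}_r(G_{r,k},k)\ge c\,(r2^{k/2}+r^2k^2)$.
   Context: All graphs are finite, simple, loopless and undirected. $\mathrm{dist}(u,v)$ is the usual graph distance (number of edges of a shortest path, $+\infty$ if there is none). For an integer $r$, let $\mathrm{Cap}_r(\ell)=\ell$ if $\ell\le r$ and $\mathrm{Cap}_r(\ell)=+\infty$ otherwise. For $A\subseteq V(G)$ and $v\in V(G)$, the $r$-profile of $v$ with respect to $A$ is the function $p_r(v,A):A\to\mathbb N\cup\{+\infty\}$, $a\mapsto \mathrm{Cap}_r(\mathrm{dist}(a,v))$. Let $\mathrm{pc}_r(G,A)=\big|\{p_r(v,A): v\in V(G)\}\setminus\{a\mapsto+\infty\}\big|$ (the number of distinct $r$-profiles with respect to $A$, not counting the constant $+\infty$ profile), and let $\mathrm{pc}_r(G,k)=\max\{\mathrm{pc}_r(G,A): A\subseteq V(G), |A|=k\}$ (the $r$-profile complexity of $G$). A graph is chordal if it has no induced cycle of length at least $4$. -}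

module Defs where

open import Data.Fin.Base as Fin using (Fin; zero; suc; toℕ)
open import Data.Fin.Properties as Fin using (any?; all?; pigeonhole)
open import Data.Fin.Subset using (Subset; _∈_; ∣_∣; inside; outside)
open import Data.Fin.Subset.Properties using (_∈?_)
open import Data.List.Base as List using (List; []; _∷_; _++_; map; filter; deduplicate; length; head; upTo; applyUpTo; allFin)
open import Data.List.Extrema.Nat using (max)
import Data.List.Membership.Propositional as List
open import Data.List.Membership.Propositional.Properties using (∈-map⁺; ∈-++⁺ˡ; ∈-++⁺ʳ)
open import Data.List.Relation.Unary.Any using (here)
open import Data.Nat.Base using (ℕ; zero; suc; _+_; _∸_; _≤_; _<_; z≤n; s≤s; s<s)
open import Data.Nat.Induction using (<-wellFounded)
open import Data.Nat.Properties as ℕ using (_≟_; _≤?_)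
open import Data.Product.Base using (Σ; ∃; _×_; _,_; proj₁; proj₂)
open import Data.Sum.Base using (_⊎_)
open import Data.Vec.Base as Vec using (Vec)
open import Data.Vec.Properties.WithK using ([]=-irrelevant)
open import Function.Base using (_∘_; const)
open import Function.Bundles using (_⇔_)
open import Function.Definitions using (Injective)
open import Induction.WellFounded using (Acc; acc)
open import Level using (0ℓ)
open import Relation.Binary.Core using (Rel)
open import Relation.Binary.Definitions as B using (Symmetric; Irreflexive)
open import Relation.Binary.PropositionalEquality using (_≡_; refl; sym; cong; subst; _≗_)
open import Relation.Nullary using (¬_; Dec; yes; no; contradiction)
open import Relation.Nullary.Construct.Add.Supremum using (_⁺; ⊤⁺; [_]) renaming (≡-dec to ⁺-≡-dec)
open import Relation.Nullary.Decidable using (¬?; _×-dec_; map′)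
open import Relation.Unary using (Decidable)

------------------------------------------------------------------------
-- Finite simple graphs

record Graph : Set₁ where
  field
    order : ℕ
  Vertex : Set
  Vertex = Fin order
  field
    Adj        : Rel Vertex 0ℓ
    adj?       : B.Decidable Adj
    adj-sym    : Symmetric Adj
    adj-irrefl : Irreflexive _≡_ Adj

-- Adjacency of i and j in the cycle 0 – 1 – ⋯ – (m-1) – 0.

Next : ∀ {m} → Rel (Fin m) 0ℓ
Next {m} i j = (suc (toℕ i) ≡ toℕ j) ⊎ (suc (toℕ i) ≡ m × toℕ j ≡ 0)

CycleAdj : ∀ {m} → Rel (Fin m) 0ℓ
CycleAdj i j = Next i j ⊎ Next j i

module _ (G : Graph) where
  open Graph G

  InducedCycle : ℕ → Set
  InducedCycle m = Σ (Fin m → Vertex) λ f →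
    Injective _≡_ _≡_ f × (∀ i j → Adj (f i) (f j) ⇔ CycleAdj i j)

  Chordal : Set
  Chordal = ∀ m → 4 ≤ m → ¬ InducedCycle m

------------------------------------------------------------------------
-- Distance

  data Walk : ℕ → Vertex → Vertex → Set where
    []  : ∀ {u} → Walk 0 u u
    _∷_ : ∀ {ℓ u v w} → Adj u v → Walk ℓ v w → Walk (suc ℓ) u w

  walk? : ∀ ℓ u v → Dec (Walk ℓ u v)
  walk? zero    u v = map′ (λ { refl → [] }) (λ { [] → refl }) (u Fin.≟ v)
  walk? (suc ℓ) u v =
    map′ (λ { (_ , e , p) → e ∷ p }) (λ { (e ∷ p) → _ , e , p })
         (any? λ w → adj? u w ×-dec walk? ℓ w v)

  -- The least ℓ such that a walk of length ℓ exists (a shortest walk is a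
  -- path), and ⊤⁺ = +∞ if there is none.  The search may stop below the
  -- order of the graph; dist-[] and dist-⊤ below confirm that this is the
  -- usual distance.

  dist : Vertex → Vertex → ℕ ⁺
  dist u v = head (filter (λ ℓ → walk? ℓ u v) (upTo order))

------------------------------------------------------------------------
-- Profiles

Cap : ℕ → ℕ ⁺ → ℕ ⁺
Cap r ⊤⁺ = ⊤⁺
Cap r [ ℓ ] with ℓ ≤? r
... | yes _ = [ ℓ ]
... | no  _ = ⊤⁺

-- The functions A → ℕ ∪ {+∞}, compared pointwise.

Profile : ∀ {n} → Subset n → Set
Profile A = ∃ (_∈ A) → ℕ ⁺

infix 4 _≗?_

_≗?_ : ∀ {n} {A : Subset n} → B.Decidable {A = Profile A} _≗_
_≗?_ {A = A} f g = map′ (λ h (a , a∈A) → h a a∈A) (λ h a a∈A → h (a , a∈A)) (all? agree?)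
  where
  agree? : ∀ a → Dec (∀ a∈A → f (a , a∈A) ≡ g (a , a∈A))
  agree? a with a ∈? A
  ... | no  a∉A = yes λ a∈A → contradiction a∈A a∉A
  ... | yes p   =
    map′ (λ eq q → subst (λ q → f (a , q) ≡ g (a , q)) ([]=-irrelevant p q) eq) (λ h → h p)
         (⁺-≡-dec _≟_ (f (a , p)) (g (a , p)))

subsets : ∀ n → List (Subset n)
subsets zero    = Vec.[] ∷ []
subsets (suc n) = map (inside Vec.∷_) (subsets n) ++ map (outside Vec.∷_) (subsets n)

module _ (G : Graph) where
  open Graph G

  profile : ℕ → Vertex → (A : Subset order) → Profile A
  profile r v A (a , _) = Cap r (dist G a v)

  pcSet : ℕ → Subset order → ℕ
  pcSet r A = length (deduplicate _≗?_ (filter (λ f → ¬? (f ≗? const ⊤⁺)) profiles))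
    where
    profiles : List (Profile A)
    profiles = map (λ v → profile r v A) (allFin order)

  -- The maximum is 0 when the graph has fewer than k vertices.

  pc : ℕ → ℕ → ℕ
  pc r k = max 0 (map (pcSet r) (filter (λ A → ∣ A ∣ ≟ k) (subsets order)))

------------------------------------------------------------------------
-- Correctness of the two searches

∈-subsets : ∀ {n} (A : Subset n) → A List.∈ subsets n
∈-subsets Vec.[]              = here refl
∈-subsets (inside  Vec.∷ A)   = ∈-++⁺ˡ (∈-map⁺ _ (∈-subsets A))
∈-subsets (outside Vec.∷ A)   = ∈-++⁺ʳ _ (∈-map⁺ _ (∈-subsets A))

module _ {P : ℕ → Set} (P? : Decidable P) where

  private
    first : (ℕ → ℕ) → ℕ → ℕ ⁺
    first f n = head (filter P? (applyUpTo f n))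

    first-[] : ∀ f n {ℓ} → first f n ≡ [ ℓ ] →
               ∃ λ i → f i ≡ ℓ × P ℓ × (∀ {j} → j < i → ¬ P (f j))
    first-[] f (suc n) eq with P? (f 0)
    first-[] f (suc n) refl | yes p = 0 , refl , p , λ ()
    ... | no ¬p with i , fi≡ℓ , p , below ← first-[] (f ∘ suc) n eq =
      suc i , fi≡ℓ , p , λ { {zero} _ → ¬p ; {suc j} (s≤s j<i) → below j<i }

    first-⊤ : ∀ f n → first f n ≡ ⊤⁺ → ∀ {j} → j < n → ¬ P (f j)
    first-⊤ f (suc n) eq j<n with P? (f 0)
    first-⊤ f (suc n) () j<n | yes p
    first-⊤ f (suc n) eq {zero}  _          | no ¬p = ¬p
    first-⊤ f (suc n) eq {suc j} (s≤s j<n) | no ¬p = first-⊤ (f ∘ suc) n eq j<n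

  least-[] : ∀ n {ℓ} → head (filter P? (upTo n)) ≡ [ ℓ ] → P ℓ × (∀ {m} → P m → ℓ ≤ m)
  least-[] n eq with i , refl , p , below ← first-[] (λ i → i) n eq =
    p , λ q → ℕ.≮⇒≥ λ m<ℓ → below m<ℓ q

  least-⊤ : ∀ n → head (filter P? (upTo n)) ≡ ⊤⁺ → ∀ {m} → m < n → ¬ P m
  least-⊤ = first-⊤ (λ i → i)

module _ (G : Graph) where
  open Graph G

  private
    at : ∀ {ℓ u v} → Walk G ℓ u v → Fin (suc ℓ) → Vertex
    at {u = u} p       zero    = u
    at         (e ∷ p) (suc i) = at p i

    takeTo : ∀ {ℓ u v} (p : Walk G ℓ u v) i → Walk G (toℕ i) u (at p i)
    takeTo p       zero    = []
    takeTo (e ∷ p) (suc i) = e ∷ takeTo p i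

    dropTo : ∀ {ℓ u v} (p : Walk G ℓ u v) i → Walk G (ℓ ∸ toℕ i) (at p i) v
    dropTo p       zero    = p
    dropTo (e ∷ p) (suc i) = dropTo p i

    append : ∀ {k ℓ u v w} → Walk G k u v → Walk G ℓ v w → Walk G (k + ℓ) u w
    append []      q = q
    append (e ∷ p) q = e ∷ append p q

    shorten : ∀ {ℓ u v} → Walk G ℓ u v → order ≤ ℓ → ∃ λ m → m < ℓ × Walk G m u v
    shorten {ℓ} {u} {v} p n≤ℓ with i , j , i<j , eq ← pigeonhole (s≤s n≤ℓ) (at p) =
      toℕ i + (ℓ ∸ toℕ j) , shorter ,
      append (subst (Walk G (toℕ i) u) eq (takeTo p i)) (dropTo p j)
      where
      shorter : toℕ i + (ℓ ∸ toℕ j) < ℓ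
      shorter = ℕ.<-≤-trans (ℕ.+-monoˡ-< (ℓ ∸ toℕ j) i<j)
                            (ℕ.≤-reflexive (ℕ.m+[n∸m]≡n (ℕ.≤-pred (Fin.toℕ<n j))))

    shortWalk : ∀ {ℓ u v} → Acc _<_ ℓ → Walk G ℓ u v → ∃ λ m → m < order × Walk G m u v
    shortWalk {ℓ} (acc rs) p with order ≤? ℓ
    ... | no  n≰ℓ = ℓ , ℕ.≰⇒> n≰ℓ , p
    ... | yes n≤ℓ with m , m<ℓ , q ← shorten p n≤ℓ = shortWalk (rs m<ℓ) q

  dist-[] : ∀ {u v ℓ} → dist G u v ≡ [ ℓ ] →
            Walk G ℓ u v × (∀ {m} → Walk G m u v → ℓ ≤ m)
  dist-[] = least-[] (λ ℓ → walk? G ℓ _ _) order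

  dist-⊤ : ∀ {u v} → dist G u v ≡ ⊤⁺ → ∀ {m} → ¬ Walk G m u v
  dist-⊤ eq p with m , m<n , q ← shortWalk (<-wellFounded _) p =
    least-⊤ (λ ℓ → walk? G ℓ _ _) order eq m<n q

{-# OPTIONS --safe #-}

-- Since 2 r 2^(k/2) ≤ r² + 2^k, it suffices to find chordal graphs with at least 2^k and with a
-- constant times r² k² profiles.  The first is a split graph: a clique indexed by the subsets of an
-- independent set A of size k, each joined to its elements.
--
-- For the second, put k = 2m and take the m-th power of a tree, in which the distance of x and y
-- is that of the tree divided by m and rounded up.  The tree is a spider with hairs of edge length m:
-- A consists of m targets at depths 1, …, m on one arm and of the tips of m other arms, of length r m.
-- From the point at height b on the hair at depth t m + j of an arm, with 0 ≤ j < m, the tip of that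
-- arm is at distance r - t + b, the other tips at distance more than r, and the target at depth l at
-- distance t + b + 1 or t + b + 2 according to whether l + j ≤ m.  So the profile determines the arm,
-- t, b and j, and there are of order r² m² choices of these.

module Submission where

open import Defs
open import Data.Empty using (⊥)
open import Data.Fin.Base as Fin
  using (Fin; zero; suc; toℕ; fromℕ; fromℕ<; inject₁; inject≤; opposite; finToFun; funToFin)
import Data.Fin.Properties as Fin
open import Data.Fin.Subset using (Subset; _∈_; _∉_; ∣_∣; inside; outside) renaming (⊥ to ∅)
open import Data.Fin.Subset.Properties using (∣⊥∣≡0; ∉⊥)
open import Data.Integer.Base as ℤ using (+_; +≤+)
import Data.Integer.Properties as ℤ
open import Data.List.Base using (List; allFin; map; filter; lookup; deduplicate)
open import Data.List.Extrema.Nat using (argmax; f[xs]≤f[argmax]; v≤max⁺)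
import Data.List.Membership.Propositional.Properties as List
import Data.List.Relation.Unary.All as All
open import Data.List.Relation.Unary.Any as Any using (Any)
import Data.List.Relation.Unary.Any.Properties as Any
open import Data.Nat.Base using (ℕ; zero; suc; _+_; _*_; _^_; _∸_; _⊓_; _≤_; _<_; z≤n; s≤s; s≤s⁻¹)
open import Data.Nat.DivMod using (_/_; _%_; m*n/n≡m; m/n*n≤m; m≡m%n+[m/n]*n; m%n<n; /-monoˡ-≤)
open import Data.Nat.Divisibility using (_∣_; divides)
open import Data.Nat.Properties
open import Data.Nat.Tactic.RingSolver using (solve-∀)
open import Data.Product.Base using (∃; ∃-syntax; _×_; _,_; proj₁; proj₂)
open import Data.Product.Function.NonDependent.Propositional using (_×-↔_)
open import Data.Rational.Base as ℚ using (ℚ; 0ℚ)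
import Data.Rational.Properties as ℚ
open import Data.Rational.Unnormalised.Base as ℚᵘ using (mkℚᵘ; *≤*)
import Data.Rational.Unnormalised.Properties as ℚᵘ
open import Data.Sum.Base using (_⊎_; inj₁; inj₂; [_,_]′)
open import Data.Sum.Properties using (inj₂-injective)
open import Data.Unit.Base using (⊤; tt)
open import Data.Vec.Base using (_∷_; here; there; _[_]≔_)
import Data.Vec.Properties as Vec
open import Function.Base using (_∘_; const)
open import Function.Bundles using (_↔_; Equivalence; Inverse)
open import Function.Construct.Composition using (_↔-∘_)
open import Function.Construct.Identity using (↔-id)
open import Function.Construct.Symmetry using (↔-sym)
open import Function.Definitions using (Injective)
open import Level using (0ℓ)
open import Relation.Binary.Core using (Rel)
open import Relation.Binary.Definitions using (Decidable; Symmetric)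
open import Relation.Binary.PropositionalEquality
open import Relation.Nullary using (¬_; yes; no; contradiction)
open import Relation.Nullary.Construct.Add.Supremum using (⊤⁺; [_])
open import Relation.Nullary.Decidable using (¬?; _×-dec_; decidable-stable)

-- Induced cycles and a criterion for chordality.

private
  CycleStep : ℕ → Rel ℕ _
  CycleStep m i j = suc i ≡ j ⊎ (suc i ≡ m × j ≡ 0)

  -- Either step may wrap around from m - 1 to 0. In each of the four cases an equality or adjacency
  -- of the outer vertices is absurd outright or forces m ≤ 3; in a triangle they would indeed be
  -- adjacent.
  two-steps-apart : ∀ {m p i n} → 4 ≤ m → CycleStep m p i → CycleStep m i n →
                    p ≢ n × ¬ (CycleStep m p n ⊎ CycleStep m n p)
  two-steps-apart 4≤m (inj₁ refl) (inj₁ refl) = (λ ()) , λ where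
    (inj₁ (inj₁ ()))
    (inj₂ (inj₂ (refl , refl))) → contradiction 4≤m λ { (s≤s (s≤s (s≤s ()))) }
  two-steps-apart 4≤m (inj₁ refl) (inj₂ (refl , refl)) =
    (λ { refl → contradiction 4≤m λ { (s≤s (s≤s ())) } }) , λ where
    (inj₁ (inj₁ ()))
    (inj₂ (inj₁ refl)) → contradiction 4≤m λ { (s≤s (s≤s (s≤s ()))) }
  two-steps-apart 4≤m (inj₂ (refl , refl)) (inj₁ refl) =
    (λ { refl → contradiction 4≤m λ { (s≤s (s≤s ())) } }) , λ where
    (inj₁ (inj₁ refl)) → contradiction 4≤m λ { (s≤s ()) }
    (inj₂ (inj₁ refl)) → contradiction 4≤m λ { (s≤s (s≤s (s≤s ()))) }
    (inj₂ (inj₂ (refl , ())))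
  two-steps-apart 4≤m (inj₂ (refl , refl)) (inj₂ (refl , _)) =
    contradiction 4≤m λ { (s≤s ()) }

  next : ∀ {m} (i : Fin m) → ∃[ j ] Next i j
  next {suc m} i with suc (toℕ i) <? suc m
  ... | yes i<m = fromℕ< i<m , inj₁ (sym (Fin.toℕ-fromℕ< i<m))
  ... | no  i≮m = zero , inj₂ (≤-antisym (Fin.toℕ<n i) (≮⇒≥ i≮m) , refl)

  prev : ∀ {m} (i : Fin m) → ∃[ j ] Next j i
  prev {suc m} zero    = fromℕ m , inj₂ (cong suc (Fin.toℕ-fromℕ m) , refl)
  prev {suc m} (suc i) = inject₁ i , inj₁ (cong suc (Fin.toℕ-inject₁ i))

module _ (G : Graph) where
  open Graph G

  -- In an induced cycle, the two neighbours of a vertex of maximal rank would be adjacent.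

  lower-neighbours-adjacent⇒chordal : (rank : Vertex → ℕ) →
    (∀ {u v w} → u ≢ w → Adj v u → Adj v w → rank u ≤ rank v → rank w ≤ rank v → Adj u w) →
    Chordal G
  lower-neighbours-adjacent⇒chordal rank adj m@(suc _) 4≤m (f , f-inj , f-adj) =
    proj₂ apart (f-adj p n .Equivalence.to
      (adj (proj₁ apart ∘ cong toℕ ∘ f-inj)
           (f-adj top p .Equivalence.from (inj₂ p→top)) (f-adj top n .Equivalence.from (inj₁ top→n))
           (top-max p) (top-max n)))
    where
    top : Fin m
    top = argmax (rank ∘ f) zero (allFin m)
    top-max : ∀ j → rank (f j) ≤ rank (f top)
    top-max j = All.lookup (f[xs]≤f[argmax] {f = rank ∘ f} zero (allFin m)) (List.∈-allFin j)
    p = proj₁ (prev top)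
    n = proj₁ (next top)
    p→top : Next p top
    p→top = proj₂ (prev top)
    top→n : Next top n
    top→n = proj₂ (next top)
    apart = two-steps-apart 4≤m p→top top→n

  -- Walks of bounded length and capped distances.

  Within : ℕ → Rel Vertex _
  Within n u v = ∃[ ℓ ] ℓ ≤ n × Walk G ℓ u v

  Within-trans : ∀ {m n u v w} → Within m u v → Within n v w → Within (m + n) u w
  Within-trans (k , k≤m , p) (ℓ , ℓ≤n , q) = k + ℓ , +-mono-≤ k≤m ℓ≤n , append p q
    where
    append : ∀ {k ℓ u v w} → Walk G k u v → Walk G ℓ v w → Walk G (k + ℓ) u w
    append []      q = q
    append (e ∷ p) q = e ∷ append p q

  Cap-≤ : ∀ {r d} → d ≤ r → Cap r [ d ] ≡ [ d ]
  Cap-≤ {r} {d} d≤r with d ≤? r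
  ... | yes _   = refl
  ... | no  d≰r = contradiction d≤r d≰r

  Cap-[] : ∀ {r d} x → Cap r x ≡ [ d ] → x ≡ [ d ]
  Cap-[] {r} [ ℓ ] eq with ℓ ≤? r
  Cap-[] [ ℓ ] refl | yes _ = refl

  Within⇒Cap-dist : ∀ {r n u v} → n ≤ r → Within n u v →
                    ∃[ d ] d ≤ n × Cap r (dist G u v) ≡ [ d ]
  Within⇒Cap-dist {u = u} {v} n≤r (ℓ , ℓ≤n , p) with dist G u v in eq
  ... | ⊤⁺    = contradiction p (dist-⊤ G eq)
  ... | [ d ] = d , d≤n , Cap-≤ (≤-trans d≤n n≤r)
    where d≤n = ≤-trans (proj₂ (dist-[] G eq) p) ℓ≤n

  -- A distance of at most n ≤ r survives the cap, so equality of the capped values hands the same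
  -- finite distance, and with it a shortest walk, to the other vertex.
  Within-respects-Cap-dist : ∀ {r n u v w} → n ≤ r → Cap r (dist G u v) ≡ Cap r (dist G u w) →
                             Within n u v → Within n u w
  Within-respects-Cap-dist n≤r eq v-near with d , d≤n , eq′ ← Within⇒Cap-dist n≤r v-near =
    d , d≤n , proj₁ (dist-[] G (Cap-[] _ (trans (sym eq) eq′)))

-- Vertex sets of prescribed size.

private
  ∣insert∣ : ∀ {n} (A : Subset n) {x} → x ∉ A → ∣ A [ x ]≔ inside ∣ ≡ suc ∣ A ∣
  ∣insert∣ (inside  ∷ A) {zero}  x∉A = contradiction here x∉A
  ∣insert∣ (outside ∷ A) {zero}  x∉A = refl
  ∣insert∣ (inside  ∷ A) {suc x} x∉A = cong suc (∣insert∣ A (x∉A ∘ there))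
  ∣insert∣ (outside ∷ A) {suc x} x∉A = ∣insert∣ A (x∉A ∘ there)

image : ∀ {k n} (a : Fin k → Fin n) → Subset n
image {zero}  a = ∅
image {suc k} a = image (a ∘ suc) [ a zero ]≔ inside

∈-image⁻ : ∀ {k n} (a : Fin k → Fin n) {x} → x ∈ image a → ∃[ i ] a i ≡ x
∈-image⁻ {zero}  a x∈ = contradiction x∈ ∉⊥
∈-image⁻ {suc k} a {x} x∈ with a zero Fin.≟ x
... | yes eq = zero , eq
... | no  ≢x with i , eq ← ∈-image⁻ (a ∘ suc)
                     (Vec.lookup⇒[]= x _ (trans (sym (Vec.lookup∘update′ (≢x ∘ sym) (image (a ∘ suc)) inside))
                                                 (Vec.[]=⇒lookup x∈))) = suc i , eq

∈-image⁺ : ∀ {k n} (a : Fin k → Fin n) i → a i ∈ image a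
∈-image⁺ a zero    = Vec.[]≔-updates _ (a zero)
∈-image⁺ a (suc i) with a zero Fin.≟ a (suc i)
... | yes eq = subst (_∈ image a) eq (∈-image⁺ a zero)
... | no  ≢a = Vec.[]≔-minimal _ _ _ (≢a ∘ sym) (∈-image⁺ (a ∘ suc) i)

∣image∣ : ∀ {k n} (a : Fin k → Fin n) → Injective _≡_ _≡_ a → ∣ image a ∣ ≡ k
∣image∣ {zero}  {n} a a-inj = ∣⊥∣≡0 n
∣image∣ {suc k} a a-inj =
  trans (∣insert∣ (image (a ∘ suc)) fresh) (cong suc (∣image∣ (a ∘ suc) (Fin.suc-injective ∘ a-inj)))
  where
  fresh : a zero ∉ image (a ∘ suc)
  fresh a₀∈ with i , eq ← ∈-image⁻ (a ∘ suc) a₀∈ with () ← a-inj eq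

-- Counting profiles through a family of separated vertices.

module _ (G : Graph) {I X : Set} {k N : ℕ} (I↔k : I ↔ Fin k) (X↔N : X ↔ Fin N)
         (a : I → Graph.Vertex G) (v : X → Graph.Vertex G) where
  private
    i# = Inverse.from I↔k
    x# = Inverse.from X↔N

  -- Profiles capped at r record exactly the relations Within n for n ≤ r.

  DominatedUpTo : ℕ → Rel X _
  DominatedUpTo r x y = ∀ i n → n ≤ r → Within G n (a i) (v x) → Within G n (a i) (v y)

  module _ {r} (a-injective : Injective _≡_ _≡_ a)
           (visible : ∀ x → ∃[ i ] Within G r (a i) (v x))
           (separated : ∀ {x y} → DominatedUpTo r x y → DominatedUpTo r y x → x ≡ y) where
    private
      from-injective : ∀ {A : Set} {n} (A↔n : A ↔ Fin n) → Injective _≡_ _≡_ (Inverse.from A↔n)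
      from-injective A↔n {x} {y} eq = trans (sym (Inverse.strictlyInverseˡ A↔n x))
        (trans (cong (Inverse.to A↔n) eq) (Inverse.strictlyInverseˡ A↔n y))

      A : Subset (Graph.order G)
      A = image (a ∘ i#)

      p : Fin N → Profile A
      p x = profile G r (v (x# x)) A

      a∈A : ∀ i → a i ∈ A
      a∈A i = subst (λ j → a j ∈ A) (Inverse.strictlyInverseʳ I↔k i) (∈-image⁺ (a ∘ i#) _)

      p-injective : ∀ {x y} → p x ≗ p y → x ≡ y
      p-injective eq = from-injective X↔N (separated
        (λ i n n≤r → Within-respects-Cap-dist G n≤r (eq (a i , a∈A i)))
        (λ i n n≤r → Within-respects-Cap-dist G n≤r (sym (eq (a i , a∈A i)))))

      p-nonconstant : ∀ x → ¬ (p x ≗ const ⊤⁺)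
      p-nonconstant x eq with i , near ← visible (x# x) =
        contradiction (trans (sym (eq (a i , a∈A i))) (proj₂ (proj₂ (Within⇒Cap-dist G ≤-refl near)))) λ ()

      nonconstant : List (Profile A)
      nonconstant = filter (λ f → ¬? (f ≗? const ⊤⁺)) (map (λ u → profile G r u A) (allFin (Graph.order G)))

      found : ∀ x → Any (p x ≗_) (deduplicate _≗?_ nonconstant)
      -- `deduplicate` keeps one representative of each profile, so what survives is an entry
      -- pointwise equal to `p x`, a property that `_≗_` respects.
      found x = Any.deduplicate⁺ _≗?_ (λ g≗h p≗h e → trans (p≗h e) (sym (g≗h e)))
        (Any.map (λ { refl e → refl })
          (List.∈-filter⁺ _ (List.∈-map⁺ (λ u → profile G r u A) (List.∈-allFin (v (x# x))))
                            (p-nonconstant x)))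

      index-injective : Injective _≡_ _≡_ (Any.index ∘ found)
      index-injective {x} {y} eq = p-injective λ e → trans (Any.lookup-index (found x) e)
        (trans (cong (λ i → lookup (deduplicate _≗?_ nonconstant) i e) eq)
               (sym (Any.lookup-index (found y) e)))

    -- The samples inject into positions of the deduplicated list: a shared position means pointwise
    -- equal profiles, which separation excludes for distinct samples.
    N≤pcSet : N ≤ pcSet G r A
    N≤pcSet = Fin.injective⇒≤ index-injective

    N≤pc : N ≤ pc G r k
    N≤pc = v≤max⁺ 0 _ (inj₂ (Any.map⁺ (Any.map (λ { refl → N≤pcSet })
      (List.∈-filter⁺ (λ A → ∣ A ∣ ≟ k) (∈-subsets A)
        (∣image∣ (a ∘ i#) (from-injective I↔k ∘ a-injective))))))

-- Graphs given by a symmetric relation.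

module RelationGraph {V : Set} {n : ℕ} (V↔n : V ↔ Fin n)
                     (_~_ : Rel V 0ℓ) (_~?_ : Decidable _~_) (~-sym : Symmetric _~_) where
  ⟦_⟧ : Fin n → V
  ⟦_⟧ = Inverse.from V↔n

  vertex : V → Fin n
  vertex = Inverse.to V↔n

  ⟦vertex⟧ : ∀ x → ⟦ vertex x ⟧ ≡ x
  ⟦vertex⟧ = Inverse.strictlyInverseʳ V↔n

  vertex-injective : Injective _≡_ _≡_ vertex
  vertex-injective {x} {y} eq = trans (sym (⟦vertex⟧ x)) (trans (cong ⟦_⟧ eq) (⟦vertex⟧ y))

  -- Loops are discarded here, so `_~_` may be reflexive, as it is on a clique and for bounded tree
  -- distance.
  graph : Graph
  graph = record
    { order      = n
    ; Adj        = λ u v → u ≢ v × ⟦ u ⟧ ~ ⟦ v ⟧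
    ; adj?       = λ u v → ¬? (u Fin.≟ v) ×-dec (⟦ u ⟧ ~? ⟦ v ⟧)
    ; adj-sym    = λ (u≢v , u~v) → u≢v ∘ sym , ~-sym u~v
    ; adj-irrefl = λ u≡v (u≢v , _) → u≢v u≡v
    }

  chordal : (rank : V → ℕ) →
            (∀ {x y z} → y ~ x → y ~ z → rank x ≤ rank y → rank z ≤ rank y → x ~ z) → Chordal graph
  chordal rank lower = lower-neighbours-adjacent⇒chordal graph (rank ∘ ⟦_⟧)
    λ u≢w (_ , v~u) (_ , v~w) u≤v w≤v → u≢w , lower v~u v~w u≤v w≤v

  ~⇒Within : ∀ x y → x ~ y → Within graph 1 (vertex x) (vertex y)
  ~⇒Within x y x~y with vertex x Fin.≟ vertex y
  ... | yes eq = 0 , z≤n , subst (Walk graph 0 (vertex x)) eq []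
  ... | no  ≢  = 1 , ≤-refl , (≢ , subst₂ _~_ (sym (⟦vertex⟧ x)) (sym (⟦vertex⟧ y)) x~y) ∷ []

  Within-1⁻ : ∀ x y → Within graph 1 (vertex x) (vertex y) → x ≡ y ⊎ x ~ y
  Within-1⁻ x y (ℓ , ℓ≤1 , p) = go ℓ≤1 refl refl p
    where
    go : ∀ {ℓ u v} → ℓ ≤ 1 → u ≡ vertex x → v ≡ vertex y → Walk graph ℓ u v → x ≡ y ⊎ x ~ y
    go _        u≡ v≡ []                   = inj₁ (vertex-injective (trans (sym u≡) v≡))
    go _        u≡ v≡ ((_ , u~v) ∷ [])     =
      inj₂ (subst₂ _~_ (trans (cong ⟦_⟧ u≡) (⟦vertex⟧ x)) (trans (cong ⟦_⟧ v≡) (⟦vertex⟧ y)) u~v)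
    go (s≤s ()) _  _  (_ ∷ (_ ∷ _))

-- The split graph, with 2^k profiles.

funToFin-cong : ∀ {m n} {f g : Fin m → Fin n} → f ≗ g → funToFin f ≡ funToFin g
funToFin-cong {zero}  f≗g = refl
funToFin-cong {suc m} f≗g = cong₂ Fin.combine (f≗g zero) (funToFin-cong (f≗g ∘ suc))

module SplitGraph (k : ℕ) where
  V : Set
  V = Fin (2 ^ k) ⊎ Fin k

  -- A clique vertex codes a subset of `Fin k` by its k binary digits, the digit `zero` marking
  -- membership.
  _∋_ : Fin (2 ^ k) → Fin k → Set
  S ∋ a = finToFun {2} {k} S a ≡ zero

  _~_ : Rel V _
  inj₁ S ~ inj₁ T = ⊤
  inj₁ S ~ inj₂ a = S ∋ a
  inj₂ a ~ inj₁ S = S ∋ a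
  inj₂ a ~ inj₂ b = ⊥

  _~?_ : Decidable _~_
  inj₁ S ~? inj₁ T = yes tt
  inj₁ S ~? inj₂ a = finToFun S a Fin.≟ zero
  inj₂ a ~? inj₁ S = finToFun S a Fin.≟ zero
  inj₂ a ~? inj₂ b = no λ ()

  ~-sym : Symmetric _~_
  ~-sym {inj₁ S} {inj₁ T} _   = tt
  ~-sym {inj₁ S} {inj₂ a} S∋a = S∋a
  ~-sym {inj₂ a} {inj₁ S} S∋a = S∋a

  open RelationGraph (↔-sym (Fin.+↔⊎ {2 ^ k} {k})) _~_ _~?_ ~-sym public

  rank : V → ℕ
  rank (inj₁ S) = 0
  rank (inj₂ a) = 1

  -- With the independent vertices ranked above the clique, the neighbours of rank at most that of a
  -- given vertex all lie in the clique.
  graph-chordal : Chordal graph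
  graph-chordal = chordal rank λ {x} {y} {z} → lower x y z
    where
    lower : ∀ x y z → y ~ x → y ~ z → rank x ≤ rank y → rank z ≤ rank y → x ~ z
    lower (inj₁ S) _        (inj₁ T) _ _ _  _  = tt
    lower (inj₂ a) (inj₁ S) _        _ _ () _
    lower (inj₁ S) (inj₁ T) (inj₂ a) _ _ _  ()

  Within-1⇒∋ : ∀ {a S} → Within graph 1 (vertex (inj₂ a)) (vertex (inj₁ S)) → S ∋ a
  Within-1⇒∋ {a} {S} near with inj₂ S∋a ← Within-1⁻ (inj₂ a) (inj₁ S) near = S∋a

  -- Through this vertex every independent vertex reaches every clique vertex in two steps. Since 2
  -- ≤ r, even the empty set then has a profile that is not constantly infinite.
  full : Fin (2 ^ k)
  full = funToFin {k} {2} (const zero)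

  full-∋ : ∀ a → full ∋ a
  full-∋ = Fin.finToFun-funToFin {k} {2} (const zero)

  ∋-extensional : ∀ {S T} → (∀ a → S ∋ a → T ∋ a) → (∀ a → T ∋ a → S ∋ a) → S ≡ T
  ∋-extensional {S} {T} S⊆T T⊆S = begin
    S                                ≡⟨ Fin.funToFin-finToFin {k} {2} S ⟨
    funToFin (finToFun {2} {k} S)    ≡⟨ funToFin-cong (λ a → bits-agree (S⊆T a) (T⊆S a)) ⟩
    funToFin (finToFun {2} {k} T)    ≡⟨ Fin.funToFin-finToFin {k} {2} T ⟩
    T                                ∎
    where
    open ≡-Reasoning
    bits-agree : ∀ {b c : Fin 2} → (b ≡ zero → c ≡ zero) → (c ≡ zero → b ≡ zero) → b ≡ c
    bits-agree {zero}                b⇒c c⇒b = sym (b⇒c refl)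
    bits-agree {suc zero} {zero}     b⇒c c⇒b = c⇒b refl
    bits-agree {suc zero} {suc zero} b⇒c c⇒b = refl

  2^k≤pc : ∀ {r} → 2 ≤ r → 1 ≤ k → 2 ^ k ≤ pc graph r k
  2^k≤pc 2≤r 1≤k = N≤pc graph (↔-id _) (↔-id _) (vertex ∘ inj₂) (vertex ∘ inj₁)
    (inj₂-injective ∘ vertex-injective)
    (λ S → fromℕ< 1≤k , visible S _)
    (λ S⊑T T⊑S → ∋-extensional (⊑⇒⊆ S⊑T) (⊑⇒⊆ T⊑S))
    where
    1≤r = ≤-trans (s≤s z≤n) 2≤r
    visible : ∀ S a → Within graph _ (vertex (inj₂ a)) (vertex (inj₁ S))
    visible S a
      with ℓ , ℓ≤2 , p ← Within-trans graph (~⇒Within (inj₂ a) (inj₁ full) (full-∋ a))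
                                            (~⇒Within (inj₁ full) (inj₁ S) tt) =
      ℓ , ≤-trans ℓ≤2 2≤r , p
    ⊑⇒⊆ : ∀ {S T} → DominatedUpTo graph (↔-id _) (↔-id _) (vertex ∘ inj₂) (vertex ∘ inj₁) _ S T →
          ∀ a → S ∋ a → T ∋ a
    ⊑⇒⊆ {S} S⊑T a S∋a = Within-1⇒∋ (S⊑T a 1 1≤r (~⇒Within (inj₂ a) (inj₁ S) S∋a))

-- Powers of trees are chordal.

-- A set of points of a weighted rooted tree, where meet x y is the depth of the last common
-- point of the paths from the root to x and y, so that x and y have distance
-- depth x + depth y - 2 meet x y.  The parent of x is its ancestor at distance s, or the root if x
-- has depth less than s.

record TreePoints (s : ℕ) : Set₁ where
  field
    V          : Set
    depth      : V → ℕ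
    meet       : V → V → ℕ
    meet-comm  : ∀ x y → meet x y ≡ meet y x
    meet≤depth : ∀ x y → meet x y ≤ depth x
    depth≤meet : ∀ x → depth x ≤ meet x x
    meet-ultra : ∀ x y z → meet x y ⊓ meet y z ≤ meet x z
    parent       : V → V
    depth-parent : ∀ x → depth (parent x) ≡ depth x ∸ s
    parent-above : ∀ x → depth (parent x) ≤ meet (parent x) x

module TreePower {s : ℕ} (T : TreePoints s) {order : ℕ} (V↔n : TreePoints.V T ↔ Fin order) where
  open TreePoints T

  meet-ultra-≤ˡ : ∀ x y z → meet x y ≤ meet y z → meet x y ≤ meet x z
  meet-ultra-≤ˡ x y z xy≤yz = ≤-trans (⊓-glb ≤-refl xy≤yz) (meet-ultra x y z)

  meet-ultra-≤ʳ : ∀ x y z → meet y z ≤ meet x y → meet y z ≤ meet x z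
  meet-ultra-≤ʳ x y z yz≤xy = ≤-trans (⊓-glb yz≤xy ≤-refl) (meet-ultra x y z)

  -- The tree distance of x and y is at most n s.

  Near : ℕ → Rel V _
  Near n x y = depth x + depth y ≤ n * s + 2 * meet x y

  Near-sym : ∀ {n} → Symmetric (Near n)
  Near-sym {n} {x} {y} = subst₂ _≤_ (+-comm (depth x) (depth y)) (cong (λ m → n * s + 2 * m) (meet-comm x y))

  Near-1? : Decidable (Near 1)
  Near-1? x y = _ ≤? _

  Near-1-sym : Symmetric (Near 1)
  Near-1-sym {x} {y} = Near-sym {1} {x} {y}

  open RelationGraph V↔n (Near 1) Near-1? Near-1-sym public

  -- Rank by depth. The smaller of the meets of x and z with y is at most `meet x z`; in the pair
  -- with that smaller meet, y is exchanged for the remaining point, which is no deeper.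
  graph-chordal : Chordal graph
  graph-chordal = chordal depth λ {x} {y} {z} → lower x y z
    where
    open ≤-Reasoning
    lower : ∀ x y z → Near 1 y x → Near 1 y z → depth x ≤ depth y → depth z ≤ depth y → Near 1 x z
    lower x y z yx yz x≤y z≤y with ≤-total (meet x y) (meet y z)
    ... | inj₁ xy≤yz = begin
      depth x + depth z       ≤⟨ +-monoʳ-≤ (depth x) z≤y ⟩
      depth x + depth y       ≤⟨ Near-1-sym {y} {x} yx ⟩
      1 * s + 2 * meet x y    ≤⟨ +-monoʳ-≤ (1 * s) (*-monoʳ-≤ 2 (meet-ultra-≤ˡ x y z xy≤yz)) ⟩
      1 * s + 2 * meet x z    ∎
    ... | inj₂ yz≤xy = begin
      depth x + depth z       ≤⟨ +-monoˡ-≤ (depth z) x≤y ⟩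
      depth y + depth z       ≤⟨ yz ⟩
      1 * s + 2 * meet y z    ≤⟨ +-monoʳ-≤ (1 * s) (*-monoʳ-≤ 2 (meet-ultra-≤ʳ x y z yz≤xy)) ⟩
      1 * s + 2 * meet x z    ∎

  -- Graph distance as rounded tree distance.

  -- The larger meet is at most `depth y`, the smaller at most `meet x z`. This is the triangle
  -- inequality of the tree, written with meets.
  meet-triangle : ∀ x y z → meet x y + meet y z ≤ depth y + meet x z
  meet-triangle x y z with ≤-total (meet x y) (meet y z)
  ... | inj₁ xy≤yz = subst (_≤ depth y + meet x z) (+-comm (meet y z) (meet x y))
    (+-mono-≤ (meet≤depth y z) (meet-ultra-≤ˡ x y z xy≤yz))
  ... | inj₂ yz≤xy = +-mono-≤ (subst (_≤ depth y) (meet-comm y x) (meet≤depth y x))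
    (meet-ultra-≤ʳ x y z yz≤xy)

  Near-trans : ∀ {m n x y z} → Near m x y → Near n y z → Near (m + n) x z
  Near-trans {m} {n} {x} {y} {z} xy yz = +-cancelʳ-≤ (2 * depth y) _ _ (begin
    depth x + depth z + 2 * depth y                ≡⟨ regroup (depth x) (depth y) (depth z) ⟩
    (depth x + depth y) + (depth y + depth z)      ≤⟨ +-mono-≤ xy yz ⟩
    (m * s + 2 * meet x y) + (n * s + 2 * meet y z) ≡⟨ collect m n s (meet x y) (meet y z) ⟩
    (m + n) * s + 2 * (meet x y + meet y z)        ≤⟨ +-monoʳ-≤ k (*-monoʳ-≤ 2 (meet-triangle x y z)) ⟩
    (m + n) * s + 2 * (depth y + meet x z)         ≡⟨ spread k (depth y) (meet x z) ⟩
    (m + n) * s + 2 * meet x z + 2 * depth y       ∎)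
    where
    open ≤-Reasoning
    k = (m + n) * s
    regroup : ∀ a b c → a + c + 2 * b ≡ (a + b) + (b + c)
    regroup = solve-∀
    collect : ∀ m n s a b → (m * s + 2 * a) + (n * s + 2 * b) ≡ (m + n) * s + 2 * (a + b)
    collect = solve-∀
    spread : ∀ k a b → k + 2 * (a + b) ≡ k + 2 * b + 2 * a
    spread = solve-∀

  Near-refl : ∀ {x} → Near 0 x x
  Near-refl {x} =
    subst (_≤ 2 * meet x x) (cong (λ n → depth x + n) (+-identityʳ _)) (*-monoʳ-≤ 2 (depth≤meet x))

  Within⇒Near : ∀ {n} x y → Within graph n (vertex x) (vertex y) → Near n x y
  Within⇒Near x y (ℓ , ℓ≤n , p) = ≤-trans (subst₂ (Near ℓ) (⟦vertex⟧ x) (⟦vertex⟧ y) (go p))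
    (+-monoˡ-≤ _ (*-monoˡ-≤ s ℓ≤n))
    where
    go : ∀ {ℓ u v} → Walk graph ℓ u v → Near ℓ ⟦ u ⟧ ⟦ v ⟧
    go {u = u} []        = Near-refl {⟦ u ⟧}
    go {suc ℓ} {u} {w} (_∷_ {v = v} (_ , uv) p) = Near-trans {1} {ℓ} {⟦ u ⟧} {⟦ v ⟧} {⟦ w ⟧} uv (go p)

  depth≤s+depth-parent : ∀ x → depth x ≤ s + depth (parent x)
  depth≤s+depth-parent x = subst (λ d → depth x ≤ s + d) (sym (depth-parent x)) (m≤n+m∸n (depth x) s)

  Near-parent : ∀ x → Near 1 x (parent x)
  Near-parent x = begin
    depth x + depth (parent x)                       ≤⟨ +-monoˡ-≤ _ (depth≤s+depth-parent x) ⟩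
    s + depth (parent x) + depth (parent x)          ≡⟨ collect s (depth (parent x)) ⟩
    1 * s + 2 * depth (parent x)                     ≤⟨ +-monoʳ-≤ (1 * s) (*-monoʳ-≤ 2 (parent-above x)) ⟩
    1 * s + 2 * meet (parent x) x                    ≡⟨ cong (λ m → 1 * s + 2 * m) (meet-comm (parent x) x) ⟩
    1 * s + 2 * meet x (parent x)                    ∎
    where
    open ≤-Reasoning
    collect : ∀ s d → s + d + d ≡ 1 * s + 2 * d
    collect = solve-∀

  -- Moving the deeper point up by s normally shortens the path by s. Otherwise the parent lies
  -- above y too, and y, being no deeper than x, is within s of it; or the parent is the root and
  -- both points have depth at most s. The budget `1 + n` leaves room for one s in these cases.
  Near-from-parent : ∀ {n} x y → depth y ≤ depth x → Near (2 + n) x y → Near (1 + n) (parent x) y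
  Near-from-parent {n} x y y≤x xy with ≤-total (depth (parent x)) (meet x y)
  ... | inj₁ p≤m = begin
    depth p + depth y                      ≤⟨ +-monoʳ-≤ (depth p) (≤-trans y≤x (depth≤s+depth-parent x)) ⟩
    depth p + (s + depth p)                ≡⟨ collect s (depth p) ⟩
    s + 2 * depth p                        ≤⟨ +-mono-≤ (m≤m+n s (n * s)) (*-monoʳ-≤ 2 p≤py) ⟩
    (1 + n) * s + 2 * meet p y             ∎
    where
    open ≤-Reasoning
    p = parent x
    p≤py = ≤-trans (⊓-glb (parent-above x) p≤m) (meet-ultra p x y)
    collect : ∀ s d → d + (s + d) ≡ s + 2 * d
    collect = solve-∀
  ... | inj₂ m≤p with s ≤? depth x
  ...   | yes s≤x = +-cancelˡ-≤ s _ _ (begin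
    s + (depth p + depth y)                ≡⟨ +-assoc s (depth p) (depth y) ⟨
    (s + depth p) + depth y                ≡⟨ cong (_+ depth y) s+p≡x ⟩
    depth x + depth y                      ≤⟨ xy ⟩
    (s + (1 + n) * s) + 2 * meet x y       ≤⟨ +-monoʳ-≤ (s + (1 + n) * s) (*-monoʳ-≤ 2 m≤py) ⟩
    (s + (1 + n) * s) + 2 * meet p y       ≡⟨ +-assoc s ((1 + n) * s) _ ⟩
    s + ((1 + n) * s + 2 * meet p y)       ∎)
    where
    open ≤-Reasoning
    p = parent x
    s+p≡x : s + depth p ≡ depth x
    s+p≡x = trans (cong (λ n → s + n) (depth-parent x)) (m+[n∸m]≡n s≤x)
    m≤py = meet-ultra-≤ʳ p x y (≤-trans m≤p (parent-above x))
  ...   | no s≰x = begin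
    depth p + depth y                      ≡⟨ cong (_+ depth y) (trans (depth-parent x) (m≤n⇒m∸n≡0 x≤s)) ⟩
    depth y                                ≤⟨ ≤-trans y≤x x≤s ⟩
    s                                      ≤⟨ m≤m+n s (n * s) ⟩
    (1 + n) * s                            ≤⟨ m≤m+n _ _ ⟩
    (1 + n) * s + 2 * meet p y             ∎
    where
    open ≤-Reasoning
    p = parent x
    x≤s = <⇒≤ (≰⇒> s≰x)

  -- Each edge of the walk moves the deeper endpoint to its parent. With `Within⇒Near` this shows
  -- that, for positive n, graph distance at most n is tree distance at most `n * s`.
  Near⇒Within : ∀ n x y → Near (suc n) x y → Within graph (suc n) (vertex x) (vertex y)
  Near⇒Within zero x y xy = ~⇒Within x y xy
  Near⇒Within (suc n) x y xy with ≤-total (depth y) (depth x)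
  ... | inj₁ y≤x = Within-trans graph (~⇒Within x (parent x) (Near-parent x))
    (Near⇒Within n (parent x) y (Near-from-parent {n} x y y≤x xy))
  ... | inj₂ x≤y = subst (λ m → Within graph m (vertex x) (vertex y)) (+-comm (suc n) 1)
    (Within-trans graph
      (Near⇒Within n x (parent y)
        (Near-sym {suc n} {parent y} {x} (Near-from-parent {n} y x x≤y (Near-sym {suc (suc n)} {x} {y} xy))))
      (~⇒Within (parent y) y (Near-1-sym {y} {parent y} (Near-parent y))))

  module _ {I X : Set} {k N : ℕ} (I↔k : I ↔ Fin k) (X↔N : X ↔ Fin N) (a : I → V) (v : X → V) where
    -- The value n = 0 is left out because distinct points may have tree distance 0, such as the
    -- copies of the root on the arms of the spider below.
    Dominated : ℕ → Rel X _
    Dominated r x y = ∀ i n → 1 ≤ n → n ≤ r → Near n (a i) (v x) → Near n (a i) (v y)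

    Near-N≤pc : ∀ {r} → 1 ≤ r → Injective _≡_ _≡_ a →
                (∀ x → ∃[ i ] Near r (a i) (v x)) →
                (∀ {x y} → Dominated r x y → Dominated r y x → x ≡ y) →
                N ≤ pc graph r k
    Near-N≤pc {r} 1≤r a-injective visible separated =
      N≤pc graph I↔k X↔N (vertex ∘ a) (vertex ∘ v) (a-injective ∘ vertex-injective)
        (λ x → proj₁ (visible x) , within (proj₁ (visible x)) x 1≤r (proj₂ (visible x)))
        (λ x⊑y y⊑x → separated (dominated x⊑y) (dominated y⊑x))
      where
      within : ∀ {n} i x → 1 ≤ n → Near n (a i) (v x) → Within graph n (vertex (a i)) (vertex (v x))
      within {suc n} i x _ = Near⇒Within n (a i) (v x)
      dominated : ∀ {x y} → DominatedUpTo graph I↔k X↔N (vertex ∘ a) (vertex ∘ v) r x y → Dominated r x y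
      dominated {y = y} x⊑y i n 1≤n n≤r near = Within⇒Near (a i) (v y) (x⊑y i n n≤r (within i _ 1≤n near))

-- The hairy spider as a tree.

×↔* : ∀ {m n} → (Fin m × Fin n) ↔ Fin (m * n)
×↔* {m} {n} = ↔-sym (Fin.*↔× {m} {n})

-- A spider whose arms have unit edges, with a path of edges of weight s hanging from each point of
-- each arm: (i , x , h) is the point at height h on the path at distance x from the root on arm i.

module HairySpider (arms length height s : ℕ) where
  Point : Set
  Point = Fin arms × Fin length × Fin (suc height)

  depth : Point → ℕ
  depth (_ , x , h) = toℕ x + toℕ h * s

  armMeet : (x y : Fin length) (h g : Fin (suc height)) → ℕ
  armMeet x y h g with x Fin.≟ y
  ... | yes _ = toℕ x + (toℕ h ⊓ toℕ g) * s
  ... | no  _ = toℕ x ⊓ toℕ y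

  meet : Point → Point → ℕ
  meet (i , x , h) (j , y , g) with i Fin.≟ j
  ... | yes _ = armMeet x y h g
  ... | no  _ = 0

  meet-same-arm : ∀ i {x y h g} → meet (i , x , h) (i , y , g) ≡ armMeet x y h g
  meet-same-arm i with i Fin.≟ i
  ... | yes _  = refl
  ... | no i≢i = contradiction refl i≢i

  meet-distinct-arms : ∀ {i j x y h g} → i ≢ j → meet (i , x , h) (j , y , g) ≡ 0
  meet-distinct-arms {i} {j} i≢j with i Fin.≟ j
  ... | yes i≡j = contradiction i≡j i≢j
  ... | no _    = refl

  armMeet-same : ∀ x {h g} → armMeet x x h g ≡ toℕ x + (toℕ h ⊓ toℕ g) * s
  armMeet-same x with x Fin.≟ x
  ... | yes _  = refl
  ... | no x≢x = contradiction refl x≢x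

  armMeet-zero : ∀ x y {g} → armMeet x y zero g ≡ toℕ x ⊓ toℕ y
  armMeet-zero x y with x Fin.≟ y
  ... | yes refl = trans (+-identityʳ _) (sym (⊓-idem (toℕ x)))
  ... | no _     = refl

  ⊓≤armMeet : ∀ x y {h g} → toℕ x ⊓ toℕ y ≤ armMeet x y h g
  ⊓≤armMeet x y with x Fin.≟ y
  ... | yes _ = ≤-trans (m⊓n≤m _ _) (m≤m+n _ _)
  ... | no _  = ≤-refl

  armMeet≤depth : ∀ x y h g → armMeet x y h g ≤ toℕ x + toℕ h * s
  armMeet≤depth x y h g with x Fin.≟ y
  ... | yes _ = +-monoʳ-≤ (toℕ x) (*-monoˡ-≤ s (m⊓n≤m (toℕ h) (toℕ g)))
  ... | no _  = ≤-trans (m⊓n≤m _ _) (m≤m+n _ _)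

  armMeet-comm : ∀ x y h g → armMeet x y h g ≡ armMeet y x g h
  armMeet-comm x y h g with x Fin.≟ y | y Fin.≟ x
  ... | yes refl | yes _   = cong (λ k → toℕ x + k * s) (⊓-comm (toℕ h) (toℕ g))
  ... | yes refl | no x≢x  = contradiction refl x≢x
  ... | no x≢x   | yes refl = contradiction refl x≢x
  ... | no _     | no _    = ⊓-comm (toℕ x) (toℕ y)

  armMeet-ultra : ∀ x y z h g k → armMeet x y h g ⊓ armMeet y z g k ≤ armMeet x z h k
  armMeet-ultra x y z h g k with x Fin.≟ y | y Fin.≟ z
  ... | yes refl | yes refl = begin
    (toℕ x + hg * s) ⊓ (toℕ x + gk * s)     ≡⟨ +-distribˡ-⊓ (toℕ x) _ _ ⟨
    toℕ x + (hg * s) ⊓ (gk * s)             ≡⟨ cong (λ n → toℕ x + n) (*-distribʳ-⊓ s hg gk) ⟨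
    toℕ x + (hg ⊓ gk) * s                   ≤⟨ +-monoʳ-≤ (toℕ x) (*-monoˡ-≤ s hg⊓gk≤hk) ⟩
    toℕ x + (toℕ h ⊓ toℕ k) * s             ≡⟨ armMeet-same x ⟨
    armMeet x x h k                         ∎
    where
    open ≤-Reasoning
    hg = toℕ h ⊓ toℕ g
    gk = toℕ g ⊓ toℕ k
    hg⊓gk≤hk = ⊓-mono-≤ (m⊓n≤m (toℕ h) (toℕ g)) (m⊓n≤n (toℕ g) (toℕ k))
  ... | yes refl | no _     = ≤-trans (m⊓n≤n _ _) (⊓≤armMeet x z)
  ... | no _     | yes refl = ≤-trans (m⊓n≤m _ _) (⊓≤armMeet x y)
  ... | no _     | no _     = ≤-trans (⊓-mono-≤ (m⊓n≤m (toℕ x) _) (m⊓n≤n _ (toℕ z))) (⊓≤armMeet x z)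

  meet-comm : ∀ p q → meet p q ≡ meet q p
  meet-comm (i , x , h) (j , y , g) with i Fin.≟ j | j Fin.≟ i
  ... | yes _    | yes _    = armMeet-comm x y h g
  ... | yes refl | no i≢i   = contradiction refl i≢i
  ... | no i≢i   | yes refl = contradiction refl i≢i
  ... | no _     | no _     = refl

  meet≤depth : ∀ p q → meet p q ≤ depth p
  meet≤depth (i , x , h) (j , y , g) with i Fin.≟ j
  ... | yes _ = armMeet≤depth x y h g
  ... | no _  = z≤n

  meet-self : ∀ p → meet p p ≡ depth p
  meet-self (i , x , h) = trans (meet-same-arm i)
    (trans (armMeet-same x) (cong (λ k → toℕ x + k * s) (⊓-idem (toℕ h))))

  meet-ultra : ∀ p q r → meet p q ⊓ meet q r ≤ meet p r
  meet-ultra (i , x , h) (j , y , g) (k , z , f) with i Fin.≟ j | j Fin.≟ k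
  ... | yes refl | yes refl = ≤-trans (armMeet-ultra x y z h g f) (≤-reflexive (sym (meet-same-arm i)))
  ... | yes refl | no _     = ≤-trans (m⊓n≤n _ _) z≤n
  ... | no _     | _        = z≤n

  back : Fin length → Fin length
  back x = fromℕ< (≤-<-trans (m∸n≤m (toℕ x) s) (Fin.toℕ<n x))

  toℕ-back : ∀ x → toℕ (back x) ≡ toℕ x ∸ s
  toℕ-back x = Fin.toℕ-fromℕ< _

  -- A hair edge has weight s, so one edge down the hair is a distance s; on the arm the same
  -- distance is s unit edges, cut off at the root.
  parent : Point → Point
  parent (i , x , zero)  = i , back x , zero
  parent (i , x , suc h) = i , x , inject₁ h

  depth-parent : ∀ p → depth (parent p) ≡ depth p ∸ s
  depth-parent (i , x , zero) = begin
    toℕ (back x) + 0     ≡⟨ +-identityʳ _ ⟩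
    toℕ (back x)         ≡⟨ toℕ-back x ⟩
    toℕ x ∸ s            ≡⟨ cong (_∸ s) (+-identityʳ (toℕ x)) ⟨
    (toℕ x + 0) ∸ s      ∎
    where open ≡-Reasoning
  depth-parent (i , x , suc h) = begin
    toℕ x + toℕ (inject₁ h) * s       ≡⟨ cong (λ k → toℕ x + k * s) (Fin.toℕ-inject₁ h) ⟩
    toℕ x + toℕ h * s                 ≡⟨ m+n∸m≡n s _ ⟨
    s + (toℕ x + toℕ h * s) ∸ s       ≡⟨ cong (_∸ s) (regroup s (toℕ x) (toℕ h)) ⟩
    toℕ x + (s + toℕ h * s) ∸ s       ∎
    where
    open ≡-Reasoning
    regroup : ∀ s x h → s + (x + h * s) ≡ x + (s + h * s)
    regroup = solve-∀

  parent-above : ∀ p → depth (parent p) ≤ meet (parent p) p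
  parent-above (i , x , zero) = ≤-reflexive (begin
    toℕ (back x) + 0                ≡⟨ +-identityʳ _ ⟩
    toℕ (back x)                    ≡⟨ m≤n⇒m⊓n≡m (≤-trans (≤-reflexive (toℕ-back x)) (m∸n≤m (toℕ x) s)) ⟨
    toℕ (back x) ⊓ toℕ x            ≡⟨ armMeet-zero (back x) x ⟨
    armMeet (back x) x zero zero    ≡⟨ meet-same-arm i ⟨
    meet (i , back x , zero) (i , x , zero) ∎)
    where open ≡-Reasoning
  parent-above (i , x , suc h) = ≤-reflexive (begin
    toℕ x + h′ * s                        ≡⟨ cong (λ k → toℕ x + k * s) (m≤n⇒m⊓n≡m h′≤1+h) ⟨
    toℕ x + (h′ ⊓ suc (toℕ h)) * s        ≡⟨ armMeet-same x ⟨
    armMeet x x (inject₁ h) (suc h)       ≡⟨ meet-same-arm i ⟨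
    meet (i , x , inject₁ h) (i , x , suc h) ∎)
    where
    open ≡-Reasoning
    h′ = toℕ (inject₁ h)
    h′≤1+h = ≤-trans (≤-reflexive (Fin.toℕ-inject₁ h)) (n≤1+n (toℕ h))

  treePoints : TreePoints s
  treePoints = record
    { V            = Point
    ; depth        = depth
    ; meet         = meet
    ; meet-comm    = meet-comm
    ; meet≤depth   = meet≤depth
    ; depth≤meet   = λ p → ≤-reflexive (sym (meet-self p))
    ; meet-ultra   = meet-ultra
    ; parent       = parent
    ; depth-parent = depth-parent
    ; parent-above = parent-above
    }

  open TreePower treePoints (×↔* ↔-∘ (↔-id (Fin arms) ×-↔ ×↔*)) public

-- Samples, tips and targets in the spider.

module SpiderPower (r m p : ℕ) (3q≤1+r : 3 * suc p ≤ suc r) where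
  q = suc p

  -- Arm `zero` carries the targets, the arms `suc i` the tips and samples. Positions run from 0 to
  -- `r * m`, and heights from 0 to p, which are q values.
  open HairySpider (suc m) (suc (r * m)) p m public

  Sample : Set
  Sample = (Fin m × Fin m) × (Fin q × Fin q)

  -- Starting at q keeps every height at most every level, so that the distance `r - level + height`
  -- to the tip of the same arm is at most r.
  level : Fin q → ℕ
  level a = q + toℕ a

  -- Levels are at most 2q - 1 and heights at most q - 1, so `3 * q ≤ suc r` keeps the distance
  -- `level + height + 1` to the nearer targets within the cap.
  level+height<r : ∀ a (b : Fin q) → suc (level a + toℕ b) ≤ r
  level+height<r a b = s≤s⁻¹ (begin
    suc (suc (q + toℕ a + toℕ b))       ≡⟨ regroup q (toℕ a) (toℕ b) ⟩
    q + (suc (toℕ a) + suc (toℕ b))     ≤⟨ +-monoʳ-≤ q (+-mono-≤ (Fin.toℕ<n a) (Fin.toℕ<n b)) ⟩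
    q + (q + q)                         ≡⟨ cong (λ k → q + (q + k)) (+-identityʳ q) ⟨
    3 * q                               ≤⟨ 3q≤1+r ⟩
    suc r                               ∎)
    where
    open ≤-Reasoning
    regroup : ∀ q a b → suc (suc (q + a + b)) ≡ q + (suc a + suc b)
    regroup = solve-∀

  height≤level : ∀ a (b : Fin q) → toℕ b ≤ level a
  height≤level a b = ≤-trans (<⇒≤ (Fin.toℕ<n b)) (m≤m+n q (toℕ a))

  1≤r : 1 ≤ r
  1≤r = ≤-trans (s≤s z≤n) (level+height<r zero zero)

  m≤r*m : m ≤ r * m
  m≤r*m = ≤-trans (≤-reflexive (sym (*-identityˡ m))) (*-monoˡ-≤ m 1≤r)

  position<length : ∀ a (j : Fin m) → level a * m + toℕ j < suc (r * m)
  position<length a j = begin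
    suc (level a * m + toℕ j)     ≡⟨ +-suc (level a * m) (toℕ j) ⟨
    level a * m + suc (toℕ j)     ≤⟨ +-monoʳ-≤ (level a * m) (Fin.toℕ<n j) ⟩
    level a * m + m               ≡⟨ +-comm (level a * m) m ⟩
    suc (level a) * m             ≤⟨ *-monoˡ-≤ m (≤-trans (s≤s (m≤m+n (level a) 0)) (level+height<r a zero)) ⟩
    r * m                         <⟨ n<1+n (r * m) ⟩
    suc (r * m)                   ∎
    where open ≤-Reasoning

  sample : Sample → Point
  sample ((i , j) , (a , b)) = suc i , fromℕ< (position<length a j) , b

  tip : Fin m → Point
  tip i = suc i , fromℕ (r * m) , zero

  target : Fin m → Point
  target l = zero , suc (inject≤ l m≤r*m) , zero

  depth-sample : ∀ i j a b → depth (sample ((i , j) , (a , b))) ≡ level a * m + toℕ j + toℕ b * m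
  depth-sample i j a b = cong (_+ toℕ b * m) (Fin.toℕ-fromℕ< (position<length a j))

  depth-tip : ∀ i → depth (tip i) ≡ r * m
  depth-tip i = trans (+-identityʳ _) (Fin.toℕ-fromℕ (r * m))

  depth-target : ∀ l → depth (target l) ≡ suc (toℕ l)
  depth-target l = trans (+-identityʳ _) (cong suc (Fin.toℕ-inject≤ l m≤r*m))

  meet-tip-sample : ∀ i j a b → meet (tip i) (sample ((i , j) , (a , b))) ≡ level a * m + toℕ j
  meet-tip-sample i j a b = begin
    meet (tip i) (sample ((i , j) , (a , b)))    ≡⟨ meet-same-arm (suc i) ⟩
    armMeet (fromℕ (r * m)) x zero b             ≡⟨ armMeet-zero (fromℕ (r * m)) x ⟩
    toℕ (fromℕ (r * m)) ⊓ toℕ x                  ≡⟨ cong₂ _⊓_ (Fin.toℕ-fromℕ (r * m)) (Fin.toℕ-fromℕ< x<) ⟩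
    r * m ⊓ (level a * m + toℕ j)                ≡⟨ m≥n⇒m⊓n≡n (s≤s⁻¹ x<) ⟩
    level a * m + toℕ j                          ∎
    where
    open ≡-Reasoning
    x< = position<length a j
    x = fromℕ< x<

  tip+sample : ∀ i′ i j a b → depth (tip i′) + depth (sample ((i , j) , (a , b))) ≡
               (r + toℕ b) * m + (level a * m + toℕ j)
  tip+sample i′ i j a b = trans (cong₂ _+_ (depth-tip i′) (depth-sample i j a b))
    (collect r (level a) (toℕ j) (toℕ b) m)
    where
    collect : ∀ r t j b m → r * m + (t * m + j + b * m) ≡ (r + b) * m + (t * m + j)
    collect = solve-∀

  tip-Near : ∀ {n} i j a b → r + toℕ b ≤ n + level a → Near n (tip i) (sample ((i , j) , (a , b)))
  tip-Near {n} i j a b r+b≤n+t = begin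
    depth (tip i) + depth x                       ≡⟨ tip+sample i i j a b ⟩
    (r + toℕ b) * m + (t * m + toℕ j)             ≤⟨ +-monoˡ-≤ _ (*-monoˡ-≤ m r+b≤n+t) ⟩
    (n + t) * m + (t * m + toℕ j)                 ≤⟨ +-monoʳ-≤ ((n + t) * m) (m≤m+n _ (toℕ j)) ⟩
    (n + t) * m + (t * m + toℕ j + toℕ j)         ≡⟨ spread n t (toℕ j) m ⟩
    n * m + 2 * (t * m + toℕ j)                   ≡⟨ cong (λ d → n * m + 2 * d) (meet-tip-sample i j a b) ⟨
    n * m + 2 * meet (tip i) x                    ∎
    where
    open ≤-Reasoning
    t = level a
    x = sample ((i , j) , (a , b))
    spread : ∀ n t j m → (n + t) * m + (t * m + j + j) ≡ n * m + 2 * (t * m + j)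
    spread = solve-∀

  -- The tree distance is `(r - t + b) * m - j`. As j < m, rounding up erases j; the bound on j
  -- gives the strict inequality from which m is cancelled.
  tip-Near⁻ : ∀ {n} i j a b → Near n (tip i) (sample ((i , j) , (a , b))) → r + toℕ b ≤ n + level a
  tip-Near⁻ {n} i j a b near =
    s≤s⁻¹ (*-cancelʳ-< m (r + toℕ b) (suc (n + t)) (+-cancelʳ-< (t * m + toℕ j) _ _ (begin-strict
      (r + toℕ b) * m + (t * m + toℕ j)        ≡⟨ tip+sample i i j a b ⟨
      depth (tip i) + depth x                  ≤⟨ near ⟩
      n * m + 2 * meet (tip i) x               ≡⟨ cong (λ d → n * m + 2 * d) (meet-tip-sample i j a b) ⟩
      n * m + 2 * (t * m + toℕ j)              ≡⟨ spread n t (toℕ j) m ⟩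
      toℕ j + ((n + t) * m + (t * m + toℕ j))  <⟨ +-monoˡ-< _ (Fin.toℕ<n j) ⟩
      m + ((n + t) * m + (t * m + toℕ j))      ≡⟨ +-assoc m _ _ ⟨
      suc (n + t) * m + (t * m + toℕ j)        ∎)))
    where
    open ≤-Reasoning
    t = level a
    x = sample ((i , j) , (a , b))
    spread : ∀ n t j m → n * m + 2 * (t * m + j) ≡ j + ((n + t) * m + (t * m + j))
    spread = solve-∀

  -- From the tip of another arm the path runs `r * m` down to the root and then at least m further,
  -- levels being positive.
  tip-Near-r⇒≡ : ∀ i′ i j a b → Near r (tip i′) (sample ((i , j) , (a , b))) → i′ ≡ i
  tip-Near-r⇒≡ i′ i j a b near = decidable-stable (i′ Fin.≟ i) λ i′≢i → <-irrefl refl (begin-strict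
    r * m                                      <⟨ m<m+n (r * m) 0<m ⟩
    r * m + m                                  ≤⟨ +-mono-≤ (*-monoˡ-≤ m (m≤m+n r (toℕ b))) m≤x ⟩
    (r + toℕ b) * m + (level a * m + toℕ j)    ≡⟨ tip+sample i′ i j a b ⟨
    depth (tip i′) + depth x                   ≤⟨ near ⟩
    r * m + 2 * meet (tip i′) x                ≡⟨ cong (λ d → r * m + 2 * d) (distinct i′≢i) ⟩
    r * m + 0                                  ≡⟨ +-identityʳ (r * m) ⟩
    r * m                                      ∎)
    where
    open ≤-Reasoning
    x = sample ((i , j) , (a , b))
    0<m : 0 < m
    0<m = ≤-<-trans z≤n (Fin.toℕ<n j)
    m≤x : m ≤ level a * m + toℕ j
    m≤x = ≤-trans (m≤m+n m ((p + toℕ a) * m)) (m≤m+n (level a * m) (toℕ j))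
    distinct : i′ ≢ i → meet (tip i′) x ≡ 0
    distinct i′≢i = meet-distinct-arms (i′≢i ∘ Fin.suc-injective)

  target+sample : ∀ l i j a b → depth (target l) + depth (sample ((i , j) , (a , b))) ≡
                  suc (toℕ l) + toℕ j + (level a + toℕ b) * m
  target+sample l i j a b = trans (cong₂ _+_ (depth-target l) (depth-sample i j a b))
    (collect (toℕ l) (level a) (toℕ j) (toℕ b) m)
    where
    collect : ∀ l t j b m → suc l + (t * m + j + b * m) ≡ suc l + j + (t + b) * m
    collect = solve-∀

  target-Near : ∀ l i j a b → suc (toℕ l) + toℕ j ≤ m →
                Near (suc (level a + toℕ b)) (target l) (sample ((i , j) , (a , b)))
  target-Near l i j a b l+j<m = begin
    depth (target l) + depth x                     ≡⟨ target+sample l i j a b ⟩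
    suc (toℕ l) + toℕ j + (t + toℕ b) * m          ≤⟨ +-monoˡ-≤ _ l+j<m ⟩
    suc (t + toℕ b) * m                            ≤⟨ m≤m+n _ _ ⟩
    suc (t + toℕ b) * m + 2 * meet (target l) x    ∎
    where
    open ≤-Reasoning
    t = level a
    x = sample ((i , j) , (a , b))

  target-Near⁻ : ∀ {n} l i j a b → Near n (target l) (sample ((i , j) , (a , b))) →
                 suc (toℕ l) + toℕ j + (level a + toℕ b) * m ≤ n * m
  -- The arms `zero` and `suc i` differ by computation, so the meet at the root reduces to 0.
  target-Near⁻ {n} l i j a b = subst₂ _≤_ (target+sample l i j a b) (+-identityʳ (n * m))

  anchor : Fin m ⊎ Fin m → Point
  anchor (inj₁ i) = tip i
  anchor (inj₂ l) = target l

  anchor-injective : Injective _≡_ _≡_ anchor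
  anchor-injective {inj₁ i} {inj₁ _} eq = cong inj₁ (Fin.suc-injective (cong proj₁ eq))
  anchor-injective {inj₁ i} {inj₂ l} ()
  anchor-injective {inj₂ l} {inj₁ i} ()
  anchor-injective {inj₂ l} {inj₂ _} eq =
    cong inj₂ (Fin.inject≤-injective m≤r*m m≤r*m _ _ (Fin.suc-injective (cong (proj₁ ∘ proj₂) eq)))

  -- Separating the samples.

  Sample↔ : Sample ↔ Fin ((m * m) * (q * q))
  Sample↔ = ×↔* ↔-∘ (×↔* ×-↔ ×↔*)

  Anchor↔ : (Fin m ⊎ Fin m) ↔ Fin (m + m)
  Anchor↔ = ↔-sym Fin.+↔⊎

  -- Seen from the tip of its arm, a sample records level a - b; seen from the targets, it records
  -- level a + b, and j is the number of targets at distance 2 + level a + b.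

  _≼_ : Rel Sample _
  ((i , j) , (a , b)) ≼ ((i′ , j′) , (a′ , b′)) =
    i ≡ i′ × toℕ b′ + toℕ a ≤ toℕ b + toℕ a′ × toℕ a′ + toℕ b′ ≤ toℕ a + toℕ b ×
    (a ≡ a′ → b ≡ b′ → toℕ j′ ≤ toℕ j)

  -- Both directions together fix a - b and a + b, hence a and b by halving; only then does the last
  -- clause apply and compare the offsets j.
  ≼-antisym : ∀ {x y} → x ≼ y → y ≼ x → x ≡ y
  ≼-antisym {(i , j) , (a , b)} {(i′ , j′) , (a′ , b′)}
    (i≡i′ , difference , sum , offset) (_ , difference′ , sum′ , offset′) =
    cong₂ _,_ (cong₂ _,_ i≡i′ j≡j′) (cong₂ _,_ a≡a′ b≡b′)
    where
    open ≤-Reasoning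
    halve : ∀ {a b a′ b′} → b′ + a ≤ b + a′ → a + b ≤ a′ + b′ → a ≤ a′
    halve {a} {b} {a′} {b′} d s = *-cancelˡ-≤ 2 (+-cancelʳ-≤ (b + b′) _ _ (begin
      2 * a + (b + b′)         ≡⟨ lhs a b b′ ⟩
      (b′ + a) + (a + b)       ≤⟨ +-mono-≤ d s ⟩
      (b + a′) + (a′ + b′)     ≡⟨ rhs a′ b b′ ⟩
      2 * a′ + (b + b′)        ∎))
      where
      lhs : ∀ a b b′ → 2 * a + (b + b′) ≡ (b′ + a) + (a + b)
      lhs = solve-∀
      rhs : ∀ a′ b b′ → (b + a′) + (a′ + b′) ≡ 2 * a′ + (b + b′)
      rhs = solve-∀
    a≡a′ : a ≡ a′
    a≡a′ = Fin.toℕ-injective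
      (≤-antisym (halve {b = toℕ b} difference sum′) (halve {b = toℕ b′} difference′ sum))
    b≡b′ : b ≡ b′
    b≡b′ = Fin.toℕ-injective (+-cancelˡ-≡ (toℕ a) _ _
      (trans (≤-antisym sum′ sum) (cong (λ k → toℕ k + toℕ b′) (sym a≡a′))))
    j≡j′ : j ≡ j′
    j≡j′ = Fin.toℕ-injective (≤-antisym (offset′ (sym a≡a′) (sym b≡b′)) (offset a≡a′ b≡b′))

  dominated⇒≼ : ∀ x y → Dominated Anchor↔ Sample↔ anchor sample r x y → x ≼ y
  dominated⇒≼ ((i , j) , (a , b)) ((i′ , j′) , (a′ , b′)) near = i≡i′ , difference , sum , offset
    where
    open ≤-Reasoning
    t = level a
    t′ = level a′
    x = sample ((i , j) , (a , b))
    x′ = sample ((i′ , j′) , (a′ , b′))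

    i≡i′ : i ≡ i′
    i≡i′ = tip-Near-r⇒≡ i i′ j′ a′ b′
      (near (inj₁ i) r 1≤r ≤-refl (tip-Near i j a b (+-monoʳ-≤ r (height≤level a b))))

    -- The exact distance from the tip of the arm to x, hence the sharpest bound available for x′.
    n = r ∸ t + toℕ b
    t<r : t < r
    t<r = ≤-trans (s≤s (m≤m+n t _)) (level+height<r a b)
    r≡ : t + (r ∸ t) ≡ r
    r≡ = m+[n∸m]≡n (<⇒≤ t<r)

    near-tip′ : Near n (tip i) x′
    near-tip′ = near (inj₁ i) n (≤-trans (m<n⇒0<n∸m t<r) (m≤m+n _ _)) (begin
        r ∸ t + toℕ b    ≤⟨ +-monoʳ-≤ (r ∸ t) (height≤level a b) ⟩
        r ∸ t + t        ≡⟨ +-comm (r ∸ t) t ⟩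
        t + (r ∸ t)      ≡⟨ r≡ ⟩
        r                ∎)
      (tip-Near i j a b (≤-reflexive (trans (cong (_+ toℕ b) (sym r≡)) (rotate t (r ∸ t) (toℕ b)))))
      where
      rotate : ∀ t d b → t + d + b ≡ d + b + t
      rotate = solve-∀

    difference : toℕ b′ + toℕ a ≤ toℕ b + toℕ a′
    difference = +-cancelˡ-≤ (r ∸ t + q) _ _ (begin
      (r ∸ t + q) + (toℕ b′ + toℕ a)    ≡⟨ lhs (r ∸ t) q (toℕ a) (toℕ b′) ⟩
      t + (r ∸ t) + toℕ b′              ≡⟨ cong (_+ toℕ b′) r≡ ⟩
      r + toℕ b′                        ≤⟨ tip-Near⁻ i j′ a′ b′ near-tip″ ⟩
      r ∸ t + toℕ b + t′                ≡⟨ rhs (r ∸ t) q (toℕ b) (toℕ a′) ⟩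
      (r ∸ t + q) + (toℕ b + toℕ a′)    ∎)
      where
      near-tip″ : Near n (tip i) (sample ((i , j′) , (a′ , b′)))
      near-tip″ = subst (λ k → Near n (tip i) (sample ((k , j′) , (a′ , b′)))) (sym i≡i′) near-tip′
      lhs : ∀ d q a b → (d + q) + (b + a) ≡ q + a + d + b
      lhs = solve-∀
      rhs : ∀ d q b a → d + b + (q + a) ≡ (d + q) + (b + a)
      rhs = solve-∀

    -- The deepest target still at distance `suc (t + toℕ b)` from x: its depth and j add up to
    -- exactly m, so any larger offset would be noticed.
    l = opposite j
    l+j≡m : suc (toℕ l) + toℕ j ≡ m
    l+j≡m = trans (cong (λ k → suc k + toℕ j) (Fin.opposite-prop j))
      (trans (sym (+-suc (m ∸ suc (toℕ j)) (toℕ j))) (m∸n+n≡m (Fin.toℕ<n j)))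

    near-target′ : suc (toℕ l) + toℕ j′ + (t′ + toℕ b′) * m ≤ suc (t + toℕ b) * m
    near-target′ = target-Near⁻ {suc (t + toℕ b)} l i′ j′ a′ b′
      (near (inj₂ l) (suc (t + toℕ b)) (s≤s z≤n) (level+height<r a b)
        (target-Near l i j a b (≤-reflexive l+j≡m)))

    sum : toℕ a′ + toℕ b′ ≤ toℕ a + toℕ b
    sum = +-cancelˡ-≤ q _ _ (subst₂ _≤_ (+-assoc q _ _) (+-assoc q _ _)
      (s≤s⁻¹ (*-cancelʳ-< m (t′ + toℕ b′) (suc (t + toℕ b))
        -- The target has positive depth, which makes the inequality strict and lets the multiples
        -- of m be compared.
        (≤-trans (s≤s (m≤n+m _ (toℕ l + toℕ j′))) near-target′))))

    offset : a ≡ a′ → b ≡ b′ → toℕ j′ ≤ toℕ j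
    offset refl refl = +-cancelˡ-≤ (suc (toℕ l)) _ _ (+-cancelʳ-≤ ((t + toℕ b) * m) _ _
      (subst (suc (toℕ l) + toℕ j′ + (t + toℕ b) * m ≤_) (cong (_+ (t + toℕ b) * m) (sym l+j≡m))
        near-target′))

  m²q²≤pc : (m * m) * (q * q) ≤ pc graph r (m + m)
  m²q²≤pc = Near-N≤pc Anchor↔ Sample↔ anchor sample 1≤r anchor-injective visible separated
    where
    visible : ∀ x → ∃[ i ] Near r (anchor i) (sample x)
    visible ((i , j) , (a , b)) = inj₁ i , tip-Near i j a b (+-monoʳ-≤ r (height≤level a b))

    separated : ∀ {x y} → Dominated Anchor↔ Sample↔ anchor sample r x y →
                Dominated Anchor↔ Sample↔ anchor sample r y x → x ≡ y
    separated x⊑y y⊑x = ≼-antisym (dominated⇒≼ _ _ x⊑y) (dominated⇒≼ _ _ y⊑x)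

-- Arithmetic of the two lower bounds.

-- The witness is q = `suc r / 3`, positive because 2 ≤ r. The remainder is at most 2, so r ≤ 3q + 1
-- ≤ 4q.
one-third : ∀ {r} → 2 ≤ r → ∃[ p ] 3 * suc p ≤ suc r × r ≤ 4 * suc p
one-third {r} 2≤r = lemma (suc r / 3) (/-monoˡ-≤ 3 (s≤s 2≤r)) (m/n*n≤m (suc r) 3) (begin
    suc r                           ≡⟨ m≡m%n+[m/n]*n (suc r) 3 ⟩
    suc r % 3 + suc r / 3 * 3       ≤⟨ +-monoˡ-≤ _ (s≤s⁻¹ (m%n<n (suc r) 3)) ⟩
    2 + suc r / 3 * 3               ∎)
  where
  open ≤-Reasoning
  lemma : ∀ q → 1 ≤ q → q * 3 ≤ suc r → suc r ≤ 2 + q * 3 → ∃[ p ] 3 * suc p ≤ suc r × r ≤ 4 * suc p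
  lemma (suc p) _ lower upper = p , subst (_≤ suc r) (*-comm (suc p) 3) lower , (begin
    r                     ≤⟨ s≤s⁻¹ upper ⟩
    1 + suc p * 3         ≤⟨ +-monoˡ-≤ (suc p * 3) (s≤s z≤n) ⟩
    suc p + suc p * 3     ≡⟨ collect p ⟩
    4 * suc p             ∎)
    where
    collect : ∀ p → suc p + suc p * 3 ≡ 4 * suc p
    collect = solve-∀

m*n≤m*m+n*n : ∀ m n → m * n ≤ m * m + n * n
m*n≤m*m+n*n m n with ≤-total m n
... | inj₁ m≤n = ≤-trans (*-monoˡ-≤ n m≤n) (m≤n+m (n * n) (m * m))
... | inj₂ n≤m = ≤-trans (*-monoʳ-≤ m n≤m) (m≤m+n (m * m) (n * n))

module _ {r m : ℕ} (1≤m : 1 ≤ m) where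
  private
    S P : ℕ
    S = 2 ^ (m + m)
    P = r ^ 2 * (m + m) ^ 2

  -- The mixed product is at most the sum of the squares, which are r^2 ≤ P and S. So the larger of
  -- S and P controls the whole sum.
  r*2^m+P≤S+2P : r * 2 ^ m + P ≤ S + 2 * P
  r*2^m+P≤S+2P = begin
    r * 2 ^ m + P                        ≤⟨ +-monoˡ-≤ P (m*n≤m*m+n*n r (2 ^ m)) ⟩
    r * r + 2 ^ m * 2 ^ m + P            ≡⟨ cong (λ e → r * r + e + P) (^-distribˡ-+-* 2 m m) ⟨
    r * r + S + P                        ≤⟨ +-monoˡ-≤ P (+-monoˡ-≤ S r*r≤P) ⟩
    P + S + P                            ≡⟨ collect P S ⟩
    S + 2 * P                            ∎
    where
    open ≤-Reasoning
    collect : ∀ P S → P + S + P ≡ S + 2 * P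
    collect = solve-∀
    r*r≤P : r * r ≤ P
    r*r≤P = begin
      r * r                  ≡⟨ cong (r *_) (*-identityʳ r) ⟨
      r ^ 2                  ≡⟨ *-identityʳ (r ^ 2) ⟨
      r ^ 2 * 1              ≤⟨ *-monoʳ-≤ (r ^ 2) (^-monoˡ-≤ 2 (≤-trans 1≤m (m≤m+n m m))) ⟩
      P                      ∎

  P≤64m²q² : ∀ {q} → r ≤ 4 * q → P ≤ 64 * ((m * m) * (q * q))
  P≤64m²q² {q} r≤4q = begin
    P                                    ≤⟨ *-monoˡ-≤ ((m + m) ^ 2) (^-monoˡ-≤ 2 r≤4q) ⟩
    (4 * q) ^ 2 * (m + m) ^ 2            ≡⟨ collect q m ⟩
    64 * ((m * m) * (q * q))             ∎
    where
    open ≤-Reasoning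
    collect : ∀ q m → (4 * q) * ((4 * q) * 1) * ((m + m) * ((m + m) * 1)) ≡ 64 * ((m * m) * (q * q))
    collect = solve-∀

  bound-by-S : ∀ {N} → P ≤ S → S ≤ N → r * 2 ^ m + P ≤ 192 * N
  bound-by-S {N} P≤S S≤N = begin
    r * 2 ^ m + P    ≤⟨ r*2^m+P≤S+2P ⟩
    S + 2 * P        ≤⟨ +-monoʳ-≤ S (*-monoʳ-≤ 2 {P} {S} P≤S) ⟩
    3 * S            ≤⟨ *-mono-≤ {3} {192} {S} {N} (m≤m+n 3 189) S≤N ⟩
    192 * N          ∎
    where open ≤-Reasoning

  -- The constant is 192 = 3 * 64: the sum is at most `3 * P`, and P is at most 64 times the number
  -- of samples. It also covers the factor 3 of `bound-by-S`.
  bound-by-P : ∀ {q N} → S ≤ P → r ≤ 4 * q → (m * m) * (q * q) ≤ N → r * 2 ^ m + P ≤ 192 * N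
  bound-by-P {q} {N} S≤P r≤4q m²q²≤N = begin
    r * 2 ^ m + P                        ≤⟨ r*2^m+P≤S+2P ⟩
    S + 2 * P                            ≤⟨ +-monoˡ-≤ (2 * P) S≤P ⟩
    3 * P                                ≤⟨ *-monoʳ-≤ 3 {P} {64 * ((m * m) * (q * q))} (P≤64m²q² {q} r≤4q) ⟩
    3 * (64 * ((m * m) * (q * q)))       ≡⟨ *-assoc 3 64 ((m * m) * (q * q)) ⟨
    192 * ((m * m) * (q * q))            ≤⟨ *-monoʳ-≤ 192 {(m * m) * (q * q)} {N} m²q²≤N ⟩
    192 * N                              ∎
    where open ≤-Reasoning

  -- The graph may depend on r and m, so comparing P with S decides between the two constructions.
  large-pc : 2 ≤ r → ∃[ G ] Chordal G × r * 2 ^ m + P ≤ 192 * pc G r (m + m)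
  large-pc 2≤r = [ split , spider (one-third 2≤r) ]′ (≤-total P S)
    where
    split : P ≤ S → ∃[ G ] Chordal G × r * 2 ^ m + P ≤ 192 * pc G r (m + m)
    split P≤S = graph , graph-chordal ,
      bound-by-S {pc graph r (m + m)} P≤S (2^k≤pc 2≤r (≤-trans 1≤m (m≤m+n m m)))
      where open SplitGraph (m + m)

    spider : (∃[ p ] 3 * suc p ≤ suc r × r ≤ 4 * suc p) →
             S ≤ P → ∃[ G ] Chordal G × r * 2 ^ m + P ≤ 192 * pc G r (m + m)
    spider (p , 3q≤1+r , r≤4q) S≤P = graph , graph-chordal ,
      bound-by-P {suc p} {pc graph r (m + m)} S≤P r≤4q m²q²≤pc
      where open SpiderPower r m p 3q≤1+r

-- Passage to rational constants.

1/192*-≤ : ∀ {x y} → x ≤ 192 * y → (+ 1 ℚ./ 192) ℚ.* (+ x ℚ./ 1) ℚ.≤ + y ℚ./ 1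
1/192*-≤ {x} {y} x≤192y = ℚ.toℚᵘ-cancel-≤ (begin
  ℚ.toℚᵘ ((+ 1 ℚ./ 192) ℚ.* (+ x ℚ./ 1))     ≃⟨ ℚ.toℚᵘ-homo-* (+ 1 ℚ./ 192) (+ x ℚ./ 1) ⟩
  1/192 ℚᵘ.* ℚ.toℚᵘ (+ x ℚ./ 1)              ≃⟨ ℚᵘ.*-congˡ {1/192} (ℚ.toℚᵘ-fromℚᵘ (mkℚᵘ (+ x) 0)) ⟩
  1/192 ℚᵘ.* mkℚᵘ (+ x) 0                    ≤⟨ *≤* cross ⟩
  mkℚᵘ (+ y) 0                               ≃⟨ ℚ.toℚᵘ-fromℚᵘ (mkℚᵘ (+ y) 0) ⟨
  ℚ.toℚᵘ (+ y ℚ./ 1)                         ∎)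
  where
  open ℚᵘ.≤-Reasoning
  -- An unnormalised rational stores its denominator minus one; in this form the inequality is a
  -- cross multiplication of integers.
  1/192 = mkℚᵘ (+ 1) 191
  cross : + 1 ℤ.* + x ℤ.* + 1 ℤ.≤ + y ℤ.* + 192
  cross = ℤ.≤-trans (ℤ.≤-reflexive (trans (ℤ.*-identityʳ _) (ℤ.*-identityˡ (+ x))))
    (ℤ.≤-trans (+≤+ x≤192y) (ℤ.≤-reflexive (trans (cong +_ (*-comm 192 y)) (ℤ.pos-* y 192))))

proposition27 : ∃[ c ] (0ℚ ℚ.< c × (∀ (r k : ℕ) → 2 ≤ r → 2 ≤ k → 2 ∣ k →
    ∃[ G ] (Chordal G ×
    c ℚ.* ((+ (r * 2 ^ (k / 2) + r ^ 2 * k ^ 2)) ℚ./ 1) ℚ.≤ ((+ pc G r k) ℚ./ 1))))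
proposition27 = + 1 ℚ./ 192 , ℚ.positive⁻¹ (+ 1 ℚ./ 192) , bound
  where
  bound : ∀ r k → 2 ≤ r → 2 ≤ k → 2 ∣ k → ∃[ G ] Chordal G ×
          (+ 1 ℚ./ 192) ℚ.* (+ (r * 2 ^ (k / 2) + r ^ 2 * k ^ 2) ℚ./ 1) ℚ.≤ + pc G r k ℚ./ 1
  -- Evenness turns k into `m * 2`, and 2 ≤ k then gives 1 ≤ m.
  bound r k@_ 2≤r 2≤k (divides m refl) = rescale (large-pc {r} {m} (*-cancelʳ-≤ 1 m 2 2≤k) 2≤r)
    where
    m*2≡m+m : m * 2 ≡ m + m
    m*2≡m+m = trans (*-comm m 2) (cong (λ n → m + n) (+-identityʳ m))
    in-terms-of-m : r * 2 ^ (k / 2) + r ^ 2 * k ^ 2 ≡ r * 2 ^ m + r ^ 2 * (m + m) ^ 2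
    in-terms-of-m = cong₂ (λ e k → r * 2 ^ e + r ^ 2 * k ^ 2) (m*n/n≡m m 2) m*2≡m+m
    rescale : (∃[ G ] Chordal G × r * 2 ^ m + r ^ 2 * (m + m) ^ 2 ≤ 192 * pc G r (m + m)) →
              ∃[ G ] Chordal G ×
              (+ 1 ℚ./ 192) ℚ.* (+ (r * 2 ^ (k / 2) + r ^ 2 * k ^ 2) ℚ./ 1) ℚ.≤ + pc G r k ℚ./ 1
    rescale (G , G-chordal , large) = G , G-chordal ,
      1/192*-≤ {r * 2 ^ (k / 2) + r ^ 2 * k ^ 2} {pc G r k}
        (subst₂ _≤_ (sym in-terms-of-m) (cong (λ k → 192 * pc G r k) (sym m*2≡m+m)) large)
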